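{- The general reduction algorithm, started from any nonzero integer quadruple, halts after finitely many steps. Let the reduced quadruple at termination be ordered as $\mathbf a=(a,b,c,d)$ with $a\le b\le c\le d$, and suppose $L(\mathbf a)=a+b+c+d\ge 0$. Then exactly one of the following holds: (i) $a+b+c\ge d>0$; (ii) $a+b+c\le 0<d$. Furthermore, if $\mathbf a=(a,b,c,d)$ (with $a\le b\le c\le d$) is a reduced quadruple with $L(\mathbf a)<0$, then $\mathbf a^*=(-d,-c,-b,-a)$ is a reduced quadruple with $L(\mathbf a^*)>0$.
   Context: Let $\mathbf S_1,\dots,\mathbf S_4$ be the $4\times4$ integer matrices acting on column vectors $(a_1,a_2,a_3,a_4)^T$ by replacing the $i$-th coordinate $a_i$ by $2\sum_{j\ne i}a_j-a_i$ and leaving the other coordinates fixed (e.g. $\mathbf S_4(a,b,c,d)^T=(a,b,c,2(a+b+c)-d)^T$). For $\mathbf v=(a,b,c,d)$ put $|\mathbf v|=|a|+|b|+|c|+|d|$ and $L(\mathbf v)=a+b+c+d$. General reduction algorithm: given an integer quadruple, (1) order it so that $a\le b\le c\le d$; then test in order $i=1,2,3,4$ whether $|\mathbf S_i\mathbf v|<|\mathbf v|$; for the first such $i$, replace $\mathbf v$ by $\mathbf S_i\mathbf v$ and repeat; (2) if no $\mathbf S_i$ strictly decreases $|\mathbf v|$, halt. A quadruple $\mathbf v$ for which no $\mathbf S_i$ strictly decreases $|\mathbf v|$ is called reduced. A reduced quadruple with $L\ge0$ satisfying (i) is called a root quadruple, one satisfying (ii) an exceptional quadruple; a reduced $\mathbf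 a$ with $L(\mathbf a)<0$ is called root (resp. exceptional) iff $\mathbf a^*$ is. -}

module Defs where

open import Data.Bool using (if_then_else_)
open import Data.Fin using (Fin; zero; suc)
import Data.Fin.Properties as Fin
open import Data.Integer using (ℤ; +_; 0ℤ; 1ℤ; -1ℤ; _+_; _-_; _*_; -_; ∣_∣; _≤_)
import Data.Integer.Properties as ℤ
open import Data.Integer.Tactic.RingSolver using (solve-∀)
open import Data.List using (allFin; find)
open import Data.List.Relation.Binary.Permutation.Propositional.Properties using (↭-length)
open import Data.List.Sort ℤ.≤-decTotalOrder using (sort; sort-↭)
open import Data.Maybe as Maybe using (Maybe; just; nothing)
import Data.Nat as ℕ
open import Data.Nat using (ℕ)
open import Data.Product using (_×_)
open import Data.Vec using (Vec; []; _∷_; cast; fromList; lookup; tabulate; toList)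
open import Data.Vec.Properties using (length-toList)
open import Relation.Binary.PropositionalEquality using (_≡_; refl; trans)
open import Relation.Nullary using (¬_; does)
open import Algebra.Properties.Monoid.Sum ℤ.+-0-monoid using (sum)

Quadruple : Set
Quadruple = Vec ℤ 4

𝟎 : Quadruple
𝟎 = 0ℤ ∷ 0ℤ ∷ 0ℤ ∷ 0ℤ ∷ []

Matrix₄ : Set
Matrix₄ = Fin 4 → Fin 4 → ℤ

infixr 8 _·_

_·_ : Matrix₄ → Quadruple → Quadruple
M · v = tabulate λ k → sum λ j → M k j * lookup v j

-- Indices are shifted: the informal S₁,…,S₄ are S zero,…,S (suc (suc (suc zero))).
-- Row i is 2 off the diagonal and -1 on it; the other rows are those of the identity.
S : Fin 4 → Matrix₄
S i k j =
  if does (k Fin.≟ i)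
  then (if does (j Fin.≟ i) then -1ℤ else + 2)
  else (if does (j Fin.≟ k) then 1ℤ else 0ℤ)

∥_∥ : Quadruple → ℕ
∥ a ∷ b ∷ c ∷ d ∷ [] ∥ = ∣ a ∣ ℕ.+ ∣ b ∣ ℕ.+ ∣ c ∣ ℕ.+ ∣ d ∣

L : Quadruple → ℤ
L (a ∷ b ∷ c ∷ d ∷ []) = a + b + c + d

_⋆ : Quadruple → Quadruple
(a ∷ b ∷ c ∷ d ∷ []) ⋆ = (- d) ∷ (- c) ∷ (- b) ∷ (- a) ∷ []

Ordered : Quadruple → Set
Ordered (a ∷ b ∷ c ∷ d ∷ []) = a ≤ b × b ≤ c × c ≤ d

Decreases : Quadruple → Fin 4 → Set
Decreases v i = ∥ S i · v ∥ ℕ.< ∥ v ∥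

Reduced : Quadruple → Set
Reduced v = ∀ i → ¬ Decreases v i

order : Quadruple → Quadruple
order v = cast (trans (↭-length (sort-↭ (toList v))) (length-toList v)) (fromList (sort (toList v)))

-- `find` scans the list from the left, so this is the least decreasing index.
firstDecreasing : Quadruple → Maybe (Fin 4)
firstDecreasing v = find (λ i → ∥ S i · v ∥ ℕ.<? ∥ v ∥) (allFin 4)

step : Quadruple → Maybe Quadruple
step v = Maybe.map (λ i → S i · order v) (firstDecreasing (order v))

-- v ⇓[ n ] a : started from v, the reduction algorithm applies exactly n of
-- the matrices and then halts, with a the final quadruple in its sorted order.
data _⇓[_]_ : Quadruple → ℕ → Quadruple → Set where
  halt     : ∀ {v} → step v ≡ nothing → v ⇓[ 0 ] order v
  continue : ∀ {v w n a} → step v ≡ just w → w ⇓[ n ] a → v ⇓[ ℕ.suc n ] a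

private
  ∷₄-cong : ∀ {a b c d a′ b′ c′ d′ : ℤ} → a ≡ a′ → b ≡ b′ → c ≡ c′ → d ≡ d′ →
            _≡_ {A = Quadruple} (a ∷ b ∷ c ∷ d ∷ []) (a′ ∷ b′ ∷ c′ ∷ d′ ∷ [])
  ∷₄-cong refl refl refl refl = refl

S₁-action : ∀ a b c d → S zero · (a ∷ b ∷ c ∷ d ∷ []) ≡ (+ 2 * (b + c + d) - a) ∷ b ∷ c ∷ d ∷ []
S₁-action a b c d = ∷₄-cong (e₁ a b c d) (e₂ a b c d) (e₃ a b c d) (e₄ a b c d)
  where
  e₁ : ∀ a b c d → -1ℤ * a + (+ 2 * b + (+ 2 * c + (+ 2 * d + 0ℤ))) ≡ + 2 * (b + c + d) - a
  e₁ = solve-∀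
  e₂ : ∀ a b c d → 0ℤ * a + (1ℤ * b + (0ℤ * c + (0ℤ * d + 0ℤ))) ≡ b
  e₂ = solve-∀
  e₃ : ∀ a b c d → 0ℤ * a + (0ℤ * b + (1ℤ * c + (0ℤ * d + 0ℤ))) ≡ c
  e₃ = solve-∀
  e₄ : ∀ a b c d → 0ℤ * a + (0ℤ * b + (0ℤ * c + (1ℤ * d + 0ℤ))) ≡ d
  e₄ = solve-∀

S₂-action : ∀ a b c d → S (suc zero) · (a ∷ b ∷ c ∷ d ∷ []) ≡ a ∷ (+ 2 * (a + c + d) - b) ∷ c ∷ d ∷ []
S₂-action a b c d = ∷₄-cong (e₁ a b c d) (e₂ a b c d) (e₃ a b c d) (e₄ a b c d)
  where
  e₁ : ∀ a b c d → 1ℤ * a + (0ℤ * b + (0ℤ * c + (0ℤ * d + 0ℤ))) ≡ a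
  e₁ = solve-∀
  e₂ : ∀ a b c d → + 2 * a + (-1ℤ * b + (+ 2 * c + (+ 2 * d + 0ℤ))) ≡ + 2 * (a + c + d) - b
  e₂ = solve-∀
  e₃ : ∀ a b c d → 0ℤ * a + (0ℤ * b + (1ℤ * c + (0ℤ * d + 0ℤ))) ≡ c
  e₃ = solve-∀
  e₄ : ∀ a b c d → 0ℤ * a + (0ℤ * b + (0ℤ * c + (1ℤ * d + 0ℤ))) ≡ d
  e₄ = solve-∀

S₃-action : ∀ a b c d → S (suc (suc zero)) · (a ∷ b ∷ c ∷ d ∷ []) ≡ a ∷ b ∷ (+ 2 * (a + b + d) - c) ∷ d ∷ []
S₃-action a b c d = ∷₄-cong (e₁ a b c d) (e₂ a b c d) (e₃ a b c d) (e₄ a b c d)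
  where
  e₁ : ∀ a b c d → 1ℤ * a + (0ℤ * b + (0ℤ * c + (0ℤ * d + 0ℤ))) ≡ a
  e₁ = solve-∀
  e₂ : ∀ a b c d → 0ℤ * a + (1ℤ * b + (0ℤ * c + (0ℤ * d + 0ℤ))) ≡ b
  e₂ = solve-∀
  e₃ : ∀ a b c d → + 2 * a + (+ 2 * b + (-1ℤ * c + (+ 2 * d + 0ℤ))) ≡ + 2 * (a + b + d) - c
  e₃ = solve-∀
  e₄ : ∀ a b c d → 0ℤ * a + (0ℤ * b + (0ℤ * c + (1ℤ * d + 0ℤ))) ≡ d
  e₄ = solve-∀

S₄-action : ∀ a b c d → S (suc (suc (suc zero))) · (a ∷ b ∷ c ∷ d ∷ []) ≡ a ∷ b ∷ c ∷ (+ 2 * (a + b + c) - d) ∷ []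
S₄-action a b c d = ∷₄-cong (e₁ a b c d) (e₂ a b c d) (e₃ a b c d) (e₄ a b c d)
  where
  e₁ : ∀ a b c d → 1ℤ * a + (0ℤ * b + (0ℤ * c + (0ℤ * d + 0ℤ))) ≡ a
  e₁ = solve-∀
  e₂ : ∀ a b c d → 0ℤ * a + (1ℤ * b + (0ℤ * c + (0ℤ * d + 0ℤ))) ≡ b
  e₂ = solve-∀
  e₃ : ∀ a b c d → 0ℤ * a + (0ℤ * b + (1ℤ * c + (0ℤ * d + 0ℤ))) ≡ c
  e₃ = solve-∀
  e₄ : ∀ a b c d → + 2 * a + (+ 2 * b + (+ 2 * c + (-1ℤ * d + 0ℤ))) ≡ + 2 * (a + b + c) - d
  e₄ = solve-∀

{-# OPTIONS --safe #-}
-- Each step strictly decreases the natural number ∥v∥, which sorting preserves,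
-- so the algorithm halts; the S i are involutions, so it never reaches 𝟎.  For a
-- sorted nonzero a with L ≥ 0 the largest entry d is positive, and since S₄ does
-- not decrease the norm, d ≤ ∣2(a+b+c) − d∣: the two signs of the right-hand side
-- are the two alternatives.  Finally S i conjugated by ⋆ is S (opposite i), and ⋆
-- preserves ∥_∥, so it preserves being reduced.
module Submission where

open import Defs
open import Data.Integer using (ℤ; 0ℤ; _+_; _≤_; _<_; _≥_; _>_)
open import Data.Product using (_×_; ∃-syntax)
open import Data.Sum using (_⊎_)
open import Data.Vec using ([]; _∷_)
open import Relation.Binary.PropositionalEquality using (_≢_)
open import Relation.Nullary using (¬_)

open import Data.Fin using (zero; suc; opposite)
open import Data.Integer using (+_; +≤+; _-_; _*_; -_; ∣_∣)
import Data.Integer.Properties as ℤ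
open import Data.Integer.Tactic.RingSolver using (solve-∀)
open import Data.List as List using (find; allFin)
open import Data.List.Membership.Propositional.Properties using (∈-allFin)
open import Data.List.Relation.Binary.Permutation.Propositional.Properties using (map⁺)
open import Data.List.Relation.Unary.All as All using (All; []; _∷_)
open import Data.List.Relation.Unary.Linked using (Linked; _∷_)
open import Data.List.Sort ℤ.≤-decTotalOrder using (sort; sort-↭; sort-↗)
open import Data.Maybe using (just; nothing)
import Data.Nat as ℕ
open import Data.Nat.Induction using (<-wellFounded)
open import Data.Nat.ListAction using (sum)
open import Data.Nat.ListAction.Properties using (sum-↭)
import Data.Nat.Properties as ℕ
import Data.Nat.Tactic.RingSolver as ℕ-Solver
open import Data.Product using (_,_)
open import Data.Sum using (inj₁; inj₂)
open import Data.Vec using (toList; fromList)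
open import Data.Vec.Properties using (toList-cast; toList∘fromList)
open import Function using (_∘_)
open import Induction.WellFounded using (Acc; acc)
open import Relation.Binary.PropositionalEquality using (_≡_; refl; sym; trans; cong; subst; subst₂; module ≡-Reasoning)
open import Relation.Nullary using (yes; no)
open import Relation.Unary using (Pred; Decidable)

find-just : ∀ {a p} {A : Set a} {P : Pred A p} (P? : Decidable P) xs {x} →
            find P? xs ≡ just x → P x
find-just P? (y List.∷ xs) eq with P? y
find-just P? (y List.∷ xs) refl | yes py = py
find-just P? (y List.∷ xs) eq   | no  _  = find-just P? xs eq

find-nothing : ∀ {a p} {A : Set a} {P : Pred A p} (P? : Decidable P) xs →
               find P? xs ≡ nothing → All (¬_ ∘ P) xs
find-nothing P? List.[]       eq = []
find-nothing P? (y List.∷ xs) eq with P? y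
find-nothing P? (y List.∷ xs) () | yes _
find-nothing P? (y List.∷ xs) eq | no ¬py = ¬py ∷ find-nothing P? xs eq

∷₄-cong : ∀ {a b c d a′ b′ c′ d′ : ℤ} → a ≡ a′ → b ≡ b′ → c ≡ c′ → d ≡ d′ →
          _≡_ {A = Quadruple} (a ∷ b ∷ c ∷ d ∷ []) (a′ ∷ b′ ∷ c′ ∷ d′ ∷ [])
∷₄-cong refl refl refl refl = refl

toList-order : ∀ v → toList (order v) ≡ sort (toList v)
toList-order v = trans (toList-cast _ (fromList (sort (toList v)))) (toList∘fromList (sort (toList v)))

-- Puts the norm in a form that `sum-↭` can handle, so that its invariance under sorting follows
-- from `sort-↭`. The final `0` is the empty tail of the list sum.
∥∥≡sum : ∀ v → ∥ v ∥ ≡ sum (List.map ∣_∣ (toList v))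
∥∥≡sum (a ∷ b ∷ c ∷ d ∷ []) = begin
  ∣ a ∣ ℕ.+ ∣ b ∣ ℕ.+ ∣ c ∣ ℕ.+ ∣ d ∣               ≡⟨ ℕ.+-assoc (∣ a ∣ ℕ.+ ∣ b ∣) ∣ c ∣ ∣ d ∣ ⟩
  ∣ a ∣ ℕ.+ ∣ b ∣ ℕ.+ (∣ c ∣ ℕ.+ ∣ d ∣)             ≡⟨ ℕ.+-assoc ∣ a ∣ ∣ b ∣ _ ⟩
  ∣ a ∣ ℕ.+ (∣ b ∣ ℕ.+ (∣ c ∣ ℕ.+ ∣ d ∣))           ≡⟨ cong (λ x → ∣ a ∣ ℕ.+ (∣ b ∣ ℕ.+ (∣ c ∣ ℕ.+ x))) (ℕ.+-identityʳ ∣ d ∣) ⟨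
  ∣ a ∣ ℕ.+ (∣ b ∣ ℕ.+ (∣ c ∣ ℕ.+ (∣ d ∣ ℕ.+ 0)))   ∎
  where open ≡-Reasoning

∥order∥ : ∀ v → ∥ order v ∥ ≡ ∥ v ∥
∥order∥ v = begin
  ∥ order v ∥                             ≡⟨ ∥∥≡sum (order v) ⟩
  sum (List.map ∣_∣ (toList (order v)))   ≡⟨ cong (sum ∘ List.map ∣_∣) (toList-order v) ⟩
  sum (List.map ∣_∣ (sort (toList v)))    ≡⟨ sum-↭ (map⁺ ∣_∣ (sort-↭ (toList v))) ⟩
  sum (List.map ∣_∣ (toList v))           ≡⟨ ∥∥≡sum v ⟨
  ∥ v ∥                                   ∎
  where open ≡-Reasoning

sorted⇒ordered : ∀ v → Linked _≤_ (toList v) → Ordered v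
sorted⇒ordered (a ∷ b ∷ c ∷ d ∷ []) (a≤b ∷ b≤c ∷ c≤d ∷ _) = a≤b , b≤c , c≤d

order-ordered : ∀ v → Ordered (order v)
order-ordered v = sorted⇒ordered (order v) (subst (Linked _≤_) (sym (toList-order v)) (sort-↗ (toList v)))

∥∥≡0⇒≡𝟎 : ∀ {v} → ∥ v ∥ ≡ 0 → v ≡ 𝟎
∥∥≡0⇒≡𝟎 {a ∷ b ∷ c ∷ d ∷ []} eq = ∷₄-cong
  (ℤ.∣i∣≡0⇒i≡0 (ℕ.m+n≡0⇒m≡0 ∣ a ∣ ab≡0))
  (ℤ.∣i∣≡0⇒i≡0 (ℕ.m+n≡0⇒n≡0 ∣ a ∣ ab≡0))
  (ℤ.∣i∣≡0⇒i≡0 (ℕ.m+n≡0⇒n≡0 (∣ a ∣ ℕ.+ ∣ b ∣) abc≡0))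
  (ℤ.∣i∣≡0⇒i≡0 (ℕ.m+n≡0⇒n≡0 (∣ a ∣ ℕ.+ ∣ b ∣ ℕ.+ ∣ c ∣) eq))
  where
  abc≡0 : ∣ a ∣ ℕ.+ ∣ b ∣ ℕ.+ ∣ c ∣ ≡ 0
  abc≡0 = ℕ.m+n≡0⇒m≡0 _ eq
  ab≡0 : ∣ a ∣ ℕ.+ ∣ b ∣ ≡ 0
  ab≡0 = ℕ.m+n≡0⇒m≡0 _ abc≡0

-- Argued through the norm: sorting preserves it, and only `𝟎` has norm 0.
order-≢𝟎 : ∀ {v} → v ≢ 𝟎 → order v ≢ 𝟎
order-≢𝟎 {v} v≢𝟎 eq = v≢𝟎 (∥∥≡0⇒≡𝟎 (trans (sym (∥order∥ v)) (cong ∥_∥ eq)))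

-- `S i` sends the entry `x` at `i` to `s - x`, where `s` is twice the sum of the other three
-- entries. These stay fixed, so the second application uses the same `s`.
S-involutive : ∀ i v → S i · S i · v ≡ v
S-involutive i (a ∷ b ∷ c ∷ d ∷ []) = go i
  where
  reflect : ∀ s x → s - (s - x) ≡ x
  reflect = solve-∀
  go : ∀ i → S i · S i · (a ∷ b ∷ c ∷ d ∷ []) ≡ a ∷ b ∷ c ∷ d ∷ []
  go i@zero = trans (cong (S i ·_) (S₁-action a b c d))
    (trans (S₁-action (+ 2 * (b + c + d) - a) b c d) (∷₄-cong (reflect (+ 2 * (b + c + d)) a) refl refl refl))
  go i@(suc zero) = trans (cong (S i ·_) (S₂-action a b c d))
    (trans (S₂-action a (+ 2 * (a + c + d) - b) c d) (∷₄-cong refl (reflect (+ 2 * (a + c + d)) b) refl refl))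
  go i@(suc (suc zero)) = trans (cong (S i ·_) (S₃-action a b c d))
    (trans (S₃-action a b (+ 2 * (a + b + d) - c) d) (∷₄-cong refl refl (reflect (+ 2 * (a + b + d)) c) refl))
  go i@(suc (suc (suc zero))) = trans (cong (S i ·_) (S₄-action a b c d))
    (trans (S₄-action a b c (+ 2 * (a + b + c) - d)) (∷₄-cong refl refl refl (reflect (+ 2 * (a + b + c)) d)))

S-𝟎 : ∀ i → S i · 𝟎 ≡ 𝟎
-- The entries of `S i` compute only for a concrete index, hence the four cases.
S-𝟎 zero                   = refl
S-𝟎 (suc zero)             = refl
S-𝟎 (suc (suc zero))       = refl
S-𝟎 (suc (suc (suc zero))) = refl

S-≢𝟎 : ∀ i {v} → v ≢ 𝟎 → S i · v ≢ 𝟎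
S-≢𝟎 i {v} v≢𝟎 eq = v≢𝟎 (trans (sym (S-involutive i v)) (trans (cong (S i ·_) eq) (S-𝟎 i)))

step-just : ∀ {v w} → step v ≡ just w → ∃[ i ] (Decreases (order v) i × w ≡ S i · order v)
step-just {v} eq with firstDecreasing (order v) in found
step-just {v} refl | just i =
  i , find-just (λ i → ∥ S i · order v ∥ ℕ.<? ∥ order v ∥) (allFin 4) found , refl

step-decreases : ∀ {v w} → step v ≡ just w → ∥ w ∥ ℕ.< ∥ v ∥
step-decreases {v} eq with step-just {v} eq
... | i , dec , refl = subst (∥ S i · order v ∥ ℕ.<_) (∥order∥ v) dec

step-≢𝟎 : ∀ {v w} → step v ≡ just w → v ≢ 𝟎 → w ≢ 𝟎
step-≢𝟎 {v} eq v≢𝟎 with step-just {v} eq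
... | i , _ , refl = S-≢𝟎 i (order-≢𝟎 v≢𝟎)

step-nothing : ∀ {v} → step v ≡ nothing → Reduced (order v)
step-nothing {v} eq with firstDecreasing (order v) in found
step-nothing {v} _ | nothing = λ i → All.lookup
  (find-nothing (λ i → ∥ S i · order v ∥ ℕ.<? ∥ order v ∥) (allFin 4) found) (∈-allFin i)

halts : ∀ v → ∃[ n ] ∃[ r ] v ⇓[ n ] r
halts v = go v (<-wellFounded ∥ v ∥)
  where
  go : ∀ v → Acc ℕ._<_ ∥ v ∥ → ∃[ n ] ∃[ r ] v ⇓[ n ] r
  go v (acc rs) with step v in eq
  ... | nothing = 0 , order v , halt eq
  ... | just w with go w (rs (step-decreases {v} eq))
  ...   | n , r , w⇓r = ℕ.suc n , r , continue eq w⇓r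

⇓-reduced : ∀ {v n r} → v ⇓[ n ] r → Reduced r
⇓-reduced {v} (halt eq)    = step-nothing {v} eq
⇓-reduced (continue _ w⇓r) = ⇓-reduced w⇓r

⇓-ordered : ∀ {v n r} → v ⇓[ n ] r → Ordered r
⇓-ordered {v} (halt _)     = order-ordered v
⇓-ordered (continue _ w⇓r) = ⇓-ordered w⇓r

-- Both alternatives of the theorem demand `0 < d`, which `𝟎` violates; nonvanishing is therefore
-- carried from the start of a run to its end.
⇓-≢𝟎 : ∀ {v n r} → v ⇓[ n ] r → v ≢ 𝟎 → r ≢ 𝟎
⇓-≢𝟎 (halt _)              = order-≢𝟎
⇓-≢𝟎 {v} (continue eq w⇓r) = ⇓-≢𝟎 w⇓r ∘ step-≢𝟎 {v} eq

nonpos-sum-nonneg⇒≡0 : ∀ {i j} → i ≤ 0ℤ → j ≤ 0ℤ → 0ℤ ≤ i + j → i ≡ 0ℤ × j ≡ 0ℤ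
nonpos-sum-nonneg⇒≡0 {i} {j} i≤0 j≤0 0≤i+j =
    ℤ.≤-antisym i≤0 (ℤ.≤-trans 0≤i+j (subst (i + j ≤_) (ℤ.+-identityʳ i) (ℤ.+-monoʳ-≤ i j≤0)))
  , ℤ.≤-antisym j≤0 (ℤ.≤-trans 0≤i+j (subst (i + j ≤_) (ℤ.+-identityˡ j) (ℤ.+-monoˡ-≤ j i≤0)))

largest-positive : ∀ {a b c d} → Ordered (a ∷ b ∷ c ∷ d ∷ []) → a ∷ b ∷ c ∷ d ∷ [] ≢ 𝟎 →
                   0ℤ ≤ L (a ∷ b ∷ c ∷ d ∷ []) → 0ℤ < d
largest-positive {a} {b} {c} {d} (a≤b , b≤c , c≤d) v≢𝟎 0≤L = ℤ.≰⇒> λ d≤0 →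
  let c≤0         = ℤ.≤-trans c≤d d≤0
      b≤0         = ℤ.≤-trans b≤c c≤0
      a≤0         = ℤ.≤-trans a≤b b≤0
      a+b≤0       = ℤ.+-mono-≤ a≤0 b≤0
      -- If `d ≤ 0`, sortedness makes every entry nonpositive, while the sum is nonnegative. The
      -- left-nested sum is split from the right until each entry is shown to vanish.
      abc≡0 , d≡0 = nonpos-sum-nonneg⇒≡0 (ℤ.+-mono-≤ a+b≤0 c≤0) d≤0 0≤L
      ab≡0 , c≡0  = nonpos-sum-nonneg⇒≡0 a+b≤0 c≤0 (ℤ.≤-reflexive (sym abc≡0))
      a≡0 , b≡0   = nonpos-sum-nonneg⇒≡0 a≤0 b≤0 (ℤ.≤-reflexive (sym ab≡0))
  in v≢𝟎 (∷₄-cong a≡0 b≡0 c≡0 d≡0)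

-- As `d` is nonnegative, the bound reads `d ≤ 2s - d` or `d ≤ -(2s - d)`. Adding `d` to the first
-- gives `2d ≤ 2s`; adding `2s - d` to the second gives `2s ≤ 0`.
∣d∣≤∣2s-d∣⇒ : ∀ s d → 0ℤ ≤ d → ∣ d ∣ ℕ.≤ ∣ + 2 * s - d ∣ → s ≥ d ⊎ s ≤ 0ℤ
∣d∣≤∣2s-d∣⇒ s d 0≤d le with ℤ.+∣i∣≡i⊎+∣i∣≡-i (+ 2 * s - d)
... | inj₁ eq = inj₁ (ℤ.*-cancelˡ-≤-pos d s (+ 2)
    (subst₂ _≤_ (double d) (cancel s d) (ℤ.+-monoʳ-≤ d d≤)))
  where
  d≤ : d ≤ + 2 * s - d
  d≤ = subst₂ _≤_ (ℤ.0≤i⇒+∣i∣≡i 0≤d) eq (+≤+ le)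
  double : ∀ d → d + d ≡ + 2 * d
  double = solve-∀
  cancel : ∀ s d → d + (+ 2 * s - d) ≡ + 2 * s
  cancel = solve-∀
... | inj₂ eq = inj₂ (ℤ.*-cancelˡ-≤-pos s 0ℤ (+ 2)
    (subst₂ _≤_ (cancelˡ s d) (cancelʳ s d) (ℤ.+-monoʳ-≤ (+ 2 * s - d) d≤)))
  where
  d≤ : d ≤ - (+ 2 * s - d)
  d≤ = subst₂ _≤_ (ℤ.0≤i⇒+∣i∣≡i 0≤d) eq (+≤+ le)
  cancelˡ : ∀ s d → + 2 * s - d + d ≡ + 2 * s
  cancelˡ = solve-∀
  cancelʳ : ∀ s d → + 2 * s - d + - (+ 2 * s - d) ≡ 0ℤ
  cancelʳ = solve-∀

-- The fourth matrix changes only the last entry, so the other three absolute values cancel from the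
-- comparison of norms.
reduced-S₄ : ∀ {a b c d} → Reduced (a ∷ b ∷ c ∷ d ∷ []) → ∣ d ∣ ℕ.≤ ∣ + 2 * (a + b + c) - d ∣
reduced-S₄ {a} {b} {c} {d} red = ℕ.+-cancelˡ-≤ (∣ a ∣ ℕ.+ ∣ b ∣ ℕ.+ ∣ c ∣) _ _
  (subst (∥ a ∷ b ∷ c ∷ d ∷ [] ∥ ℕ.≤_) (cong ∥_∥ (S₄-action a b c d))
    (ℕ.≮⇒≥ (red (suc (suc (suc zero))))))

root-or-exceptional : ∀ {a b c d} → Reduced (a ∷ b ∷ c ∷ d ∷ []) → 0ℤ < d →
                      (a + b + c ≥ d × d > 0ℤ) ⊎ (a + b + c ≤ 0ℤ × 0ℤ < d)
root-or-exceptional {a} {b} {c} {d} red 0<d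
  with ∣d∣≤∣2s-d∣⇒ (a + b + c) d (ℤ.<⇒≤ 0<d) (reduced-S₄ {a} {b} {c} {d} red)
... | inj₁ d≤s = inj₁ (d≤s , 0<d)
... | inj₂ s≤0 = inj₂ (s≤0 , 0<d)

-- `⋆` is negation composed with reversal. The linear map `S i` commutes with negation, and reversal
-- turns the index `i` into `opposite i`.
S-⋆ : ∀ i v → S i · (v ⋆) ≡ (S (opposite i) · v) ⋆
S-⋆ i (a ∷ b ∷ c ∷ d ∷ []) = go i
  where
  -- Here `w` is the replaced entry and `x`, `y`, `z` are the fixed ones, listed backwards on the
  -- left because `⋆` reverses them; one identity thus serves all four indices.
  neg : ∀ x y z w → + 2 * (- z + - y + - x) - - w ≡ - (+ 2 * (x + y + z) - w)
  neg = solve-∀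
  go : ∀ i → S i · ((a ∷ b ∷ c ∷ d ∷ []) ⋆) ≡ (S (opposite i) · (a ∷ b ∷ c ∷ d ∷ [])) ⋆
  go zero = trans (S₁-action (- d) (- c) (- b) (- a))
    (trans (∷₄-cong (neg a b c d) refl refl refl) (cong _⋆ (sym (S₄-action a b c d))))
  go (suc zero) = trans (S₂-action (- d) (- c) (- b) (- a))
    (trans (∷₄-cong refl (neg a b d c) refl refl) (cong _⋆ (sym (S₃-action a b c d))))
  go (suc (suc zero)) = trans (S₃-action (- d) (- c) (- b) (- a))
    (trans (∷₄-cong refl refl (neg a c d b) refl) (cong _⋆ (sym (S₂-action a b c d))))
  go (suc (suc (suc zero))) = trans (S₄-action (- d) (- c) (- b) (- a))
    (trans (∷₄-cong refl refl refl (neg b c d a)) (cong _⋆ (sym (S₁-action a b c d))))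

∥⋆∥ : ∀ v → ∥ v ⋆ ∥ ≡ ∥ v ∥
∥⋆∥ (a ∷ b ∷ c ∷ d ∷ [])
  rewrite ℤ.∣-i∣≡∣i∣ a | ℤ.∣-i∣≡∣i∣ b | ℤ.∣-i∣≡∣i∣ c | ℤ.∣-i∣≡∣i∣ d = reverse (∣ a ∣) (∣ b ∣) (∣ c ∣) (∣ d ∣)
  where
  reverse : ∀ w x y z → z ℕ.+ y ℕ.+ x ℕ.+ w ≡ w ℕ.+ x ℕ.+ y ℕ.+ z
  reverse = ℕ-Solver.solve-∀

-- A decrease of `v ⋆` at `i` would be a decrease of `v` at `opposite i`, since `⋆` preserves the
-- norm on both sides.
⋆-reduced : ∀ {v} → Reduced v → Reduced (v ⋆)
⋆-reduced {v} red i dec = red (opposite i)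
  (subst₂ ℕ._<_ (trans (cong ∥_∥ (S-⋆ i v)) (∥⋆∥ (S (opposite i) · v))) (∥⋆∥ v) dec)

L-⋆ : ∀ v → L (v ⋆) ≡ - L v
L-⋆ (a ∷ b ∷ c ∷ d ∷ []) = reverse a b c d
  where
  reverse : ∀ a b c d → - d + - c + - b + - a ≡ - (a + b + c + d)
  reverse = solve-∀

theorem3p1 : (∀ v → v ≢ 𝟎 →
    (∃[ n ] ∃[ r ] v ⇓[ n ] r)
    × (∀ n a b c d → v ⇓[ n ] (a ∷ b ∷ c ∷ d ∷ []) →
    Reduced (a ∷ b ∷ c ∷ d ∷ [])
    × Ordered (a ∷ b ∷ c ∷ d ∷ [])
    × (L (a ∷ b ∷ c ∷ d ∷ []) ≥ 0ℤ →
    ((a + b + c ≥ d × d > 0ℤ) ⊎ (a + b + c ≤ 0ℤ × 0ℤ < d))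
    × ¬ ((a + b + c ≥ d × d > 0ℤ) × (a + b + c ≤ 0ℤ × 0ℤ < d)))))
    × (∀ r → Ordered r → Reduced r → L r < 0ℤ →
    Reduced (r ⋆) × L (r ⋆) > 0ℤ)
theorem3p1 =
    (λ v v≢𝟎 → halts v , λ n a b c d v⇓r →
      let red = ⇓-reduced v⇓r
          ord = ⇓-ordered v⇓r
      in red , ord , λ L≥0 →
          root-or-exceptional {a} {b} {c} {d} red (largest-positive ord (⇓-≢𝟎 v⇓r v≢𝟎) L≥0)
        -- The alternatives exclude each other: together they give `d ≤ a + b + c ≤ 0`, against
        -- `0 < d`.
        , λ { ((d≤s , 0<d) , (s≤0 , _)) → ℤ.<⇒≱ 0<d (ℤ.≤-trans d≤s s≤0) })
  , (λ r _ red L<0 → ⋆-reduced {r} red , subst (0ℤ <_) (sym (L-⋆ r)) (ℤ.neg-mono-< L<0))
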